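{- For every odd integer $n \ge 17$ with $n \ne 27$, there exists an $n$-vertex graph without induced $5$-cycles which is $\frac{n-1}{2}$-regular if $n \equiv 1 \pmod 4$, and almost $\frac{n-1}{2}$-regular if $n \equiv 3 \pmod 4$. For $n = 27$, there exists a $27$-vertex graph without induced $5$-cycles in which the total number of triangles and anti-triangles equals $M(27)+1 = 645$.
   Context: A graph is $d$-regular if every vertex has degree $d$. A graph is almost $d$-regular if all vertices except one have degree $d$ and the remaining vertex has degree $d+1$ or $d-1$. A triangle is a set of three pairwise adjacent vertices; an anti-triangle is a set of three pairwise non-adjacent vertices. For $n=2m+1$ with $m$ odd, $M(n) = \frac{1}{6}(2m-3)(m-1)(m+1)$; in particular $M(27)=644$. -}

module Defs where

open import Data.Nat using (ℕ; zero; suc; _+_; _<ᵇ_)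
open import Data.Bool using (Bool; true; false; if_then_else_; _∧_)
open import Data.Fin using (Fin; toℕ)
open import Data.List using (List; map; allFin; concatMap)
open import Data.Nat.ListAction using (sum)
open import Data.Product using (Σ; ∃; _×_; _,_)
open import Data.Sum using (_⊎_)
open import Relation.Nullary using (¬_)
open import Relation.Binary.PropositionalEquality using (_≡_; _≢_)

record Graph (n : ℕ) : Set where
  field
    adj    : Fin n → Fin n → Bool
    adj-sym    : ∀ i j → adj i j ≡ adj j i
    adj-irrefl : ∀ i → adj i i ≡ false
open Graph public

[_] : Bool → ℕ
[ b ] = if b then 1 else 0

degree : ∀ {n} → Graph n → Fin n → ℕ
degree {n} G v = sum (map (λ j → [ adj G v j ]) (allFin n))

Regular : ∀ {n} → Graph n → ℕ → Set
Regular {n} G d = ∀ (v : Fin n) → degree G v ≡ d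

AlmostRegular : ∀ {n} → Graph n → ℕ → Set
AlmostRegular {n} G d =
  Σ (Fin n) λ v₀ → (degree G v₀ ≡ suc d ⊎ suc (degree G v₀) ≡ d)
                 × (∀ (v : Fin n) → v ≢ v₀ → degree G v ≡ d)

InducedC5 : ∀ {n} → Graph n → Fin n → Fin n → Fin n → Fin n → Fin n → Set
InducedC5 G a b c d e =
  (a ≢ b × a ≢ c × a ≢ d × a ≢ e × b ≢ c × b ≢ d × b ≢ e × c ≢ d × c ≢ e × d ≢ e)
  × (adj G a b ≡ true × adj G b c ≡ true × adj G c d ≡ true × adj G d e ≡ true × adj G e a ≡ true)
  × (adj G a c ≡ false × adj G a d ≡ false × adj G b d ≡ false × adj G b e ≡ false × adj G c e ≡ false)

C5Free : ∀ {n} → Graph n → Set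
C5Free {n} G = ¬ (Σ (Fin n) λ a → Σ (Fin n) λ b → Σ (Fin n) λ c → Σ (Fin n) λ d → Σ (Fin n) λ e →
                   InducedC5 G a b c d e)

_==_ : Bool → Bool → Bool
true  == true  = true
false == false = true
_     == _     = false

mono : ∀ {n} → Graph n → Fin n → Fin n → Fin n → ℕ
mono G i j k =
  [ (toℕ i <ᵇ toℕ j) ∧ (toℕ j <ᵇ toℕ k)
    ∧ (adj G i j == adj G j k) ∧ (adj G j k == adj G i k) ]

triAntiCount : ∀ {n} → Graph n → ℕ
triAntiCount {n} G =
  sum (concatMap (λ i → concatMap (λ j → map (λ k → mono G i j k) (allFin n)) (allFin n)) (allFin n))

{-# OPTIONS --safe #-}
-- All graphs are compositions of the 3 × 3 rook graph: each vertex i is replaced by a graph G i on w i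
-- vertices, and edges of the rook graph become complete bipartite graphs.  The pentagon is a prime graph,
-- so a composition of pentagon-free graphs is pentagon-free; and it is D-regular as soon as each G i is
-- d i - regular with d i + Σ (w j over the rook neighbours j of i) = D.  The inner graphs are edgeless graphs,
-- matchings, unions of triangles and 4-cycles, and complements of these (for n ≡ 3 mod 4 one of them is
-- K₂ ∪ K₁, which provides the exceptional vertex).  Adding one vertex to all parts but the first raises n
-- by 8 and D by 4, which gives an infinite family for every odd residue of n modulo 8; the remaining
-- small n, and n = 27, are compositions of the rook graph as well.
module Submission where

open import Defs
open import Data.Bool using (Bool; true; false; not; if_then_else_; _∨_; _xor_)
open import Data.Bool.Properties as Bool using (∨-zeroʳ)
open import Data.Fin using (Fin; zero; suc; toℕ; _↑ˡ_; _↑ʳ_; splitAt; quotRem)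
open import Data.Fin.Properties using (_≟_; all?; splitAt-↑ˡ; splitAt-↑ʳ; join-splitAt)
open import Data.List using (tabulate)
open import Data.List.Properties using (map-tabulate)
open import Data.Nat using (ℕ; zero; suc; _+_; _*_; _≤_; _∸_; _/_; _%_)
open import Data.Nat.DivMod using (m*n/n≡m; [m+kn]%n≡m%n; DivMod; _divMod_; result)
import Data.Nat.ListAction as List
open import Data.Nat.Properties as ℕ hiding (_≟_)
open import Data.Nat.Tactic.RingSolver using (solve-∀)
open import Data.Product using (Σ; ∃; _×_; _,_; proj₁; proj₂; uncurry)
open import Data.Sum as Sum using (inj₁; inj₂; [_,_]′)
open import Data.Vec as Vec using (Vec; []; _∷_; lookup)
open import Data.Vec.Functional using (Vector; tail)
open import Data.Vec.Relation.Binary.Pointwise.Inductive as Pointwise using (Pointwise; []; _∷_)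
open import Data.Vec.Relation.Unary.All using (All; []; _∷_)
open import Data.Vec.Relation.Unary.All.Properties using (lookup⁺)
open import Function using (_∘_; case_of_)
open import Relation.Binary.PropositionalEquality using (_≡_; _≢_; refl; sym; trans; cong; cong₂; subst; subst₂; module ≡-Reasoning)
open import Relation.Nullary using (¬_; ¬?; yes; no; does; contradiction; Dec)
open import Relation.Nullary.Decidable using (True; toWitness; from-yes; _→-dec_; decidable-stable)

open import Algebra.Properties.Semiring.Sum +-*-semiring
  using (sum; ∑-distrib-+; sum-cong-≗; *-distribˡ-sum)

private variable
  h m n d : ℕ
  V : Set

-- Finite sums and degrees.

sum-tabulate : (f : Vector ℕ n) → List.sum (tabulate f) ≡ sum f
sum-tabulate {zero}  f = refl
sum-tabulate {suc n} f = cong (f zero +_) (sum-tabulate (f ∘ suc))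

degree≡sum : (G : Graph n) (v : Fin n) → degree G v ≡ sum (λ j → [ adj G v j ])
degree≡sum G v = trans (cong List.sum (map-tabulate (λ j → j) (λ j → [ adj G v j ]))) (sum-tabulate (λ j → [ adj G v j ]))

sum-+ : ∀ m (f : Vector ℕ (m + n)) → sum f ≡ sum (λ i → f (i ↑ˡ n)) + sum (λ j → f (m ↑ʳ j))
sum-+ zero    f = refl
sum-+ (suc m) f = trans (cong (f zero +_) (sum-+ m (tail f))) (sym (+-assoc (f zero) _ _))

sum-const : ∀ n c → sum {n} (λ _ → c) ≡ n * c
sum-const zero    c = refl
sum-const (suc n) c = cong (c +_) (sum-const n c)

sum-δ : (i : Fin n) (f : Vector ℕ n) → sum (λ j → if does (i ≟ j) then f j else 0) ≡ f i
sum-δ {suc n} zero f = trans (cong (f zero +_) (trans (sum-const n 0) (*-zeroʳ n))) (+-identityʳ (f zero))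
sum-δ (suc i) f = sum-δ i (tail f)

-- Pentagons and modules.

-- The chords are listed in the cyclic direction, like the edges, so that `rotate` only shifts the
-- fields.
record Pentagon (_~_ : V → V → Bool) (a b c d e : V) : Set where
  constructor pentagon
  field
    ab : a ~ b ≡ true
    bc : b ~ c ≡ true
    cd : c ~ d ≡ true
    de : d ~ e ≡ true
    ea : e ~ a ≡ true
    ac : a ~ c ≡ false
    bd : b ~ d ≡ false
    ce : c ~ e ≡ false
    da : d ~ a ≡ false
    eb : e ~ b ≡ false

PentagonFree : (V → V → Bool) → Set
PentagonFree {V} _~_ = ∀ {a b c d e : V} → ¬ Pentagon _~_ a b c d e

pentagonFree⇒C5Free : (G : Graph n) → PentagonFree (adj G) → C5Free G
pentagonFree⇒C5Free G free (a , b , c , d , e , _ , (ab , bc , cd , de , ea) , (ac , ad , bd , be , ce)) =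
  free (pentagon ab bc cd de ea ac bd ce (trans (adj-sym G d a) ad) (trans (adj-sym G e b) be))

module _ {_~_ : V → V → Bool} where
  rotate : ∀ {a b c d e} → Pentagon _~_ a b c d e → Pentagon _~_ b c d e a
  rotate (pentagon ab bc cd de ea ac bd ce da eb) = pentagon bc cd de ea ab bd ce da eb ac

-- The pattern mentions vertices only through the relation, so it transports along any map `f`.
pullback : {U : Set} {_~_ : V → V → Bool} (f : U → V) → PentagonFree _~_ → PentagonFree (λ u v → f u ~ f v)
pullback f free (pentagon ab bc cd de ea ac bd ce da eb) = free (pentagon ab bc cd de ea ac bd ce da eb)

true≢false : ∀ {b} → b ≡ true → b ≢ false
true≢false refl ()

-- `distinguishes` says that parts are modules: a vertex that tells apart two members of a part
-- belongs to it. In a pentagon the only modules are single vertices and the whole, so its five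
-- vertices lie in different parts.
module Parts {I : Set} (_~_ : V → V → Bool) (~-sym : ∀ p q → (p ~ q) ≡ (q ~ p)) (part : V → I)
  (distinguishes : ∀ p q r → part p ≡ part q → (r ~ p) ≡ true → (r ~ q) ≡ false → part r ≡ part p)
  (no-inner-pentagon : ∀ {a b c d e} → part b ≡ part a → part c ≡ part a → part d ≡ part a → part e ≡ part a →
                       ¬ Pentagon _~_ a b c d e)
  where

  private
    flip : ∀ {p q v} → (p ~ q) ≡ v → (q ~ p) ≡ v
    flip {p} {q} = trans (~-sym q p)

  -- If `a` and `b` share a part, then `c` joins it (adjacent to `b`, not to `a`), then `d`
  -- (adjacent to `c`, not to `a`), and also `e` (adjacent to `a`, not to `b`); this puts the whole
  -- pentagon in one part.
  adjacent-≢ : ∀ {a b c d e} → Pentagon _~_ a b c d e → part a ≢ part b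
  adjacent-≢ {a} {b} {c} {d} {e} P a≡b = no-inner-pentagon (sym a≡b) c≡a d≡a e≡a P
    where
    open Pentagon P
    c≡a : part c ≡ part a
    c≡a = trans (distinguishes b a c (sym a≡b) (flip bc) (flip ac)) (sym a≡b)
    d≡a : part d ≡ part a
    d≡a = trans (distinguishes c a d c≡a (flip cd) da) c≡a
    e≡a : part e ≡ part a
    e≡a = distinguishes a b e a≡b ea eb

  -- `e` is adjacent to `a` but not to `c`, so it joins their part, and the adjacent pair `e`, `a`
  -- contradicts `adjacent-≢`.
  nonadjacent-≢ : ∀ {a b c d e} → Pentagon _~_ a b c d e → part a ≢ part c
  nonadjacent-≢ {a} {b} {c} {d} {e} P a≡c =
    adjacent-≢ (rotate (rotate (rotate (rotate P)))) (distinguishes a c e a≡c ea (flip ce))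
    where open Pentagon P

-- Composition of graphs.

outerDegree : Graph h → Vector ℕ h → Fin h → ℕ
outerDegree H w i = sum (λ j → [ adj H i j ] * w j)

module Composition (H : Graph h) (w : Vector ℕ h) (G : ∀ i → Graph (w i)) where

  Vertex : Set
  Vertex = Σ (Fin h) (Fin ∘ w)

  infix 4 _~_
  _~_ : Vertex → Vertex → Bool
  (i , x) ~ (j , y) with i ≟ j
  ... | yes refl = adj (G i) x y
  ... | no  _    = adj H i j

  ~-inner : ∀ {i} x y → ((i , x) ~ (i , y)) ≡ adj (G i) x y
  ~-inner {i} x y with i ≟ i
  ... | yes refl = refl
  ... | no  i≢i  = contradiction refl i≢i

  ~-outer : ∀ p q → proj₁ p ≢ proj₁ q → (p ~ q) ≡ adj H (proj₁ p) (proj₁ q)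
  ~-outer (i , x) (j , y) i≢j with i ≟ j
  ... | yes i≡j = contradiction i≡j i≢j
  ... | no  _   = refl

  ~-sym : ∀ p q → (p ~ q) ≡ (q ~ p)
  ~-sym (i , x) (j , y) with i ≟ j
  ... | yes refl = trans (adj-sym (G i) x y) (sym (~-inner y x))
  ... | no  i≢j  = trans (adj-sym H i j) (sym (~-outer (j , y) (i , x) (i≢j ∘ sym)))

  ~-irrefl : ∀ p → (p ~ p) ≡ false
  ~-irrefl (i , x) = trans (~-inner x x) (adj-irrefl (G i) x)

  -- A vertex outside a part does not distinguish the vertices of that part.
  distinguishes : ∀ p q r → proj₁ p ≡ proj₁ q → (r ~ p) ≡ true → (r ~ q) ≡ false → proj₁ r ≡ proj₁ p
  distinguishes p q@(_ , _) r refl rp rq = decidable-stable (proj₁ r ≟ proj₁ p) λ r≢p →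
    contradiction (trans (sym (~-outer r q r≢p)) rq) (true≢false (trans (sym (~-outer r p r≢p)) rp))

  module _ (H-free : PentagonFree (adj H)) (G-free : ∀ i → PentagonFree (adj (G i))) where

    no-inner-pentagon : ∀ {a b c d e} → proj₁ b ≡ proj₁ a → proj₁ c ≡ proj₁ a → proj₁ d ≡ proj₁ a → proj₁ e ≡ proj₁ a →
                        ¬ Pentagon _~_ a b c d e
    no-inner-pentagon {i , a} {_ , b} {_ , c} {_ , d} {_ , e} refl refl refl refl
                      (pentagon ab bc cd de ea ac bd ce da eb) =
      G-free i (pentagon (in′ a b ab) (in′ b c bc) (in′ c d cd) (in′ d e de) (in′ e a ea)
                         (in′ a c ac) (in′ b d bd) (in′ c e ce) (in′ d a da) (in′ e b eb))
      where
      in′ : ∀ x y {v} → ((i , x) ~ (i , y)) ≡ v → adj (G i) x y ≡ v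
      in′ x y = trans (sym (~-inner x y))

    -- `adjacent-≢` and `nonadjacent-≢` on the five rotations cover all ten pairs, so every edge and
    -- chord is read off from `H`, which then contains a pentagon.
    ~-pentagonFree : PentagonFree _~_
    ~-pentagonFree {a} {b} {c} {d} {e} P@(pentagon ab bc cd de ea ac bd ce da eb) = H-free
      (pentagon (out a b (adjacent-≢ P) ab) (out b c (adjacent-≢ P₁) bc) (out c d (adjacent-≢ P₂) cd)
                (out d e (adjacent-≢ P₃) de) (out e a (adjacent-≢ P₄) ea)
                (out a c (nonadjacent-≢ P) ac) (out b d (nonadjacent-≢ P₁) bd) (out c e (nonadjacent-≢ P₂) ce)
                (out d a (nonadjacent-≢ P₃) da) (out e b (nonadjacent-≢ P₄) eb))
      where
      open Parts _~_ ~-sym proj₁ distinguishes no-inner-pentagon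
      P₁ = rotate P
      P₂ = rotate P₁
      P₃ = rotate P₂
      P₄ = rotate P₃
      out : ∀ p q {v} → proj₁ p ≢ proj₁ q → (p ~ q) ≡ v → adj H (proj₁ p) (proj₁ q) ≡ v
      out p q p≢q = trans (sym (~-outer p q p≢q))

  private
    -- Both summands are written for every `j`: for `j` equal to `i` the second vanishes because `H`
    -- has no loops, otherwise the first does.
    row : ∀ i x j → sum (λ y → [ (i , x) ~ (j , y) ])
                    ≡ (if does (i ≟ j) then degree (G i) x else 0) + [ adj H i j ] * w j
    row i x j with i ≟ j
    ... | yes refl rewrite adj-irrefl H i = trans (sym (degree≡sum (G i) x)) (sym (+-identityʳ _))
    ... | no  _    = trans (sum-const (w j) [ adj H i j ]) (*-comm (w j) [ adj H i j ])

  sum-~ : ∀ i x → sum (λ j → sum (λ y → [ (i , x) ~ (j , y) ])) ≡ degree (G i) x + outerDegree H w i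
  sum-~ i x = begin
    sum (λ j → sum (λ y → [ (i , x) ~ (j , y) ]))
      ≡⟨ sum-cong-≗ (row i x) ⟩
    sum (λ j → (if does (i ≟ j) then degree (G i) x else 0) + [ adj H i j ] * w j)
      ≡⟨ ∑-distrib-+ _ (λ j → [ adj H i j ] * w j) ⟩
    sum (λ j → if does (i ≟ j) then degree (G i) x else 0) + outerDegree H w i
      ≡⟨ cong (_+ outerDegree H w i) (sum-δ i (λ _ → degree (G i) x)) ⟩
    degree (G i) x + outerDegree H w i ∎
    where open ≡-Reasoning

-- Numbering the vertices of a composition part by part.

encode : (w : Vector ℕ h) → Σ (Fin h) (Fin ∘ w) → Fin (sum w)
encode w (zero  , x) = x ↑ˡ sum (tail w)
encode w (suc i , x) = w zero ↑ʳ encode (tail w) (i , x)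

decode : (w : Vector ℕ h) → Fin (sum w) → Σ (Fin h) (Fin ∘ w)
decode {suc h} w v =
  [ zero ,_ , (λ u → suc (proj₁ (decode (tail w) u)) , proj₂ (decode (tail w) u)) ]′ (splitAt (w zero) v)

decode-encode : (w : Vector ℕ h) → ∀ p → decode w (encode w p) ≡ p
decode-encode {suc h} w (zero  , x) rewrite splitAt-↑ˡ (w zero) x (sum (tail w)) = refl
decode-encode {suc h} w (suc i , x)
  rewrite splitAt-↑ʳ (w zero) (sum (tail w)) (encode (tail w) (i , x)) | decode-encode (tail w) (i , x) = refl

encode-surjective : (w : Vector ℕ h) → ∀ v → ∃ λ p → v ≡ encode w p
encode-surjective {suc h} w v with splitAt (w zero) v | join-splitAt (w zero) (sum (tail w)) v
... | inj₁ x | eq = (zero , x) , sym eq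
... | inj₂ u | eq with encode-surjective (tail w) u
...   | (i , x) , refl = (suc i , x) , sym eq

sum-encode : (w : Vector ℕ h) (f : Vector ℕ (sum w)) → sum f ≡ sum (λ i → sum (λ x → f (encode w (i , x))))
sum-encode {zero}  w f = refl
sum-encode {suc h} w f = trans (sum-+ (w zero) f)
  (cong (sum (λ x → f (encode w (zero , x))) +_) (sum-encode (tail w) (λ v → f (w zero ↑ʳ v))))

record PentagonFreeGraph (n : ℕ) : Set where
  field
    graph        : Graph n
    pentagonFree : PentagonFree (adj graph)
open PentagonFreeGraph

compose : (H : PentagonFreeGraph h) (w : Vector ℕ h) (G : ∀ i → PentagonFreeGraph (w i)) → PentagonFreeGraph (sum w)
compose H w G = record
  { graph = record
    { adj        = λ u v → decode w u ~ decode w v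
    ; adj-sym    = λ u v → ~-sym (decode w u) (decode w v)
    ; adj-irrefl = λ u → ~-irrefl (decode w u)
    }
  ; pentagonFree = pullback (decode w) (~-pentagonFree (pentagonFree H) (pentagonFree ∘ G))
  }
  where open Composition (graph H) w (graph ∘ G)

degree-compose : (H : PentagonFreeGraph h) (w : Vector ℕ h) (G : ∀ i → PentagonFreeGraph (w i)) → ∀ i x →
  degree (graph (compose H w G)) (encode w (i , x)) ≡ degree (graph (G i)) x + outerDegree (graph H) w i
degree-compose H w G i x = begin
  degree (graph (compose H w G)) (encode w (i , x))
    ≡⟨ degree≡sum (graph (compose H w G)) (encode w (i , x)) ⟩
  sum (λ v → [ decode w (encode w (i , x)) ~ decode w v ])
    ≡⟨ sum-cong-≗ (λ v → cong (λ p → [ p ~ decode w v ]) (decode-encode w (i , x))) ⟩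
  sum (λ v → [ (i , x) ~ decode w v ])
    ≡⟨ sum-encode w _ ⟩
  sum (λ j → sum (λ y → [ (i , x) ~ decode w (encode w (j , y)) ]))
    ≡⟨ sum-cong-≗ (λ j → sum-cong-≗ (λ y → cong (λ p → [ (i , x) ~ p ]) (decode-encode w (j , y)))) ⟩
  sum (λ j → sum (λ y → [ (i , x) ~ (j , y) ]))
    ≡⟨ sum-~ i x ⟩
  degree (graph (G i)) x + outerDegree (graph H) w i ∎
  where
  open Composition (graph H) w (graph ∘ G) using (_~_; sum-~)
  open ≡-Reasoning

-- Edgeless graphs and complements.

edgeless : ∀ n → PentagonFreeGraph n
edgeless n = record
  { graph        = record { adj = λ _ _ → false ; adj-sym = λ _ _ → refl ; adj-irrefl = λ _ → refl }
  ; pentagonFree = λ P → case Pentagon.ab P of λ ()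
  }

complement : PentagonFreeGraph n → PentagonFreeGraph n
complement {n} G = record
  { graph        = record { adj = _~_ ; adj-sym = ~-sym ; adj-irrefl = ~-irrefl }
  ; pentagonFree = λ {a} {b} {c} {d} {e} P → let open Pentagon P in
      -- the complement of the pentagon abcde is the pentagon acebd
      pentagonFree G (pentagon
        (nonedge (sym-~ da) cd ac) (nonedge (sym-~ ac) ea ce) (nonedge (sym-~ ce) bc eb)
        (nonedge (sym-~ eb) de bd) (nonedge (sym-~ bd) ab da)
        (edge (sym-~ ea)) (edge (sym-~ bc)) (edge (sym-~ de)) (edge (sym-~ ab)) (edge (sym-~ cd)))
  }
  where
  _∼_ : Fin n → Fin n → Bool
  _∼_ = adj (graph G)
  _~_ : Fin n → Fin n → Bool
  i ~ j = not (i ∼ j ∨ does (i ≟ j))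
  ~-sym : ∀ i j → (i ~ j) ≡ (j ~ i)
  ~-sym i j with i ≟ j | j ≟ i
  ... | yes _   | yes _   = cong (λ b → not (b ∨ true)) (adj-sym (graph G) i j)
  ... | no _    | no _    = cong (λ b → not (b ∨ false)) (adj-sym (graph G) i j)
  ... | yes i≡j | no j≢i  = contradiction (sym i≡j) j≢i
  ... | no i≢j  | yes j≡i = contradiction (sym j≡i) i≢j
  ~-irrefl : ∀ i → (i ~ i) ≡ false
  ~-irrefl i with i ≟ i
  ... | yes _  = cong not (∨-zeroʳ (i ∼ i))
  ... | no i≢i = contradiction refl i≢i
  sym-~ : ∀ {i j b} → (i ~ j) ≡ b → (j ~ i) ≡ b
  sym-~ {i} {j} = trans (~-sym j i)
  edge : ∀ {i j} → (i ~ j) ≡ true → (i ∼ j) ≡ false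
  edge {i} {j} eq with i ∼ j
  edge () | true
  ... | false = refl
  -- Non-adjacency in the complement leaves adjacency in `G` or `i` equal to `j`; the vertex `k`,
  -- adjacent in the complement to `j` but not to `i`, excludes equality.
  nonedge : ∀ {i j k} → (i ~ k) ≡ false → (j ~ k) ≡ true → (i ~ j) ≡ false → (i ∼ j) ≡ true
  nonedge {i} {j} ik jk ij with i ∼ j | i ≟ j
  ... | true  | _        = refl
  nonedge ik jk () | false | no _
  ... | false | yes refl = contradiction ik (true≢false jk)

-- Every `j` is exactly one of: a neighbour of `v`, a neighbour in the complement, `v` itself. The
-- `suc` counts `v`.
degree-complement : (G : PentagonFreeGraph n) → ∀ v → degree (graph G) v + suc (degree (graph (complement G)) v) ≡ n
degree-complement {n} G v = begin
  degree (graph G) v + suc (degree (graph (complement G)) v)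
    ≡⟨ cong₂ (λ x y → x + suc y) (degree≡sum (graph G) v) (degree≡sum (graph (complement G)) v) ⟩
  sum e + suc (sum ē)
    ≡⟨ cong (sum e +_) (+-comm 1 (sum ē)) ⟩
  sum e + (sum ē + 1)
    ≡⟨ cong (λ x → sum e + (sum ē + x)) (sum-δ v (λ _ → 1)) ⟨
  sum e + (sum ē + sum δ)
    ≡⟨ cong (sum e +_) (∑-distrib-+ ē δ) ⟨
  sum e + sum (λ j → ē j + δ j)
    ≡⟨ ∑-distrib-+ e (λ j → ē j + δ j) ⟨
  sum (λ j → e j + (ē j + δ j))
    ≡⟨ sum-cong-≗ one ⟩
  sum {n} (λ _ → 1)
    ≡⟨ trans (sum-const n 1) (*-identityʳ n) ⟩
  n ∎
  where
  open ≡-Reasoning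
  e ē δ : Vector ℕ n
  e j = [ adj (graph G) v j ]
  ē j = [ adj (graph (complement G)) v j ]
  δ j = if does (v ≟ j) then 1 else 0
  one : ∀ j → e j + (ē j + δ j) ≡ 1
  one j with v ≟ j
  ... | yes refl rewrite adj-irrefl (graph G) v = refl
  ... | no _ with adj (graph G) v j
  ...   | true  = refl
  ...   | false = refl

-- Regularity of compositions.

Reg AlmostReg : ℕ → ℕ → Set
Reg       n d = Σ (PentagonFreeGraph n) λ G → Regular (graph G) d
AlmostReg n d = Σ (PentagonFreeGraph n) λ G → AlmostRegular (graph G) d

regularCompose : (H : PentagonFreeGraph h) (w d : Vector ℕ h) {D : ℕ} →
  (∀ i → d i + outerDegree (graph H) w i ≡ D) → (∀ i → Reg (w i) (d i)) → Reg (sum w) D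
regularCompose H w d eq G = compose H w (proj₁ ∘ G) , λ v → case encode-surjective w v of λ where
  ((i , x) , refl) → trans (degree-compose H w (proj₁ ∘ G) i x)
                           (trans (cong (_+ outerDegree (graph H) w i) (proj₂ (G i) x)) (eq i))

-- The exceptional vertex lies in part `zero`; adding the outer degree of that part leaves its
-- deviation by one unchanged.
almostRegularCompose : (H : PentagonFreeGraph (suc h)) (w d : Vector ℕ (suc h)) {D : ℕ} →
  (∀ i → d i + outerDegree (graph H) w i ≡ D) →
  AlmostReg (w zero) (d zero) → (∀ i → Reg (w (suc i)) (d (suc i))) → AlmostReg (sum w) D
almostRegularCompose H w d eq (A , x₀ , deg-x₀ , deg-A) B =
  compose H w G , encode w (zero , x₀) ,
  Sum.map (λ e → trans (deg zero x₀) (trans (cong (_+ outer zero) e) (cong suc (eq zero))))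
          (λ e → trans (cong suc (deg zero x₀)) (trans (cong (_+ outer zero) e) (eq zero))) deg-x₀ ,
  λ v v≢v₀ → case encode-surjective w v of λ where
    ((zero , x) , refl) → trans (deg zero x)
      (trans (cong (_+ outer zero) (deg-A x (λ x≡x₀ → v≢v₀ (cong (λ y → encode w (zero , y)) x≡x₀)))) (eq zero))
    ((suc i , x) , refl) → trans (deg (suc i) x) (trans (cong (_+ outer (suc i)) (proj₂ (B i) x)) (eq (suc i)))
  where
  G : ∀ i → PentagonFreeGraph (w i)
  G zero    = A
  G (suc i) = proj₁ (B i)
  outer = outerDegree (graph H) w
  deg = degree-compose H w G

regularComplement : ∀ r → r + suc d ≡ n → Reg n r → Reg n d
regularComplement {d} {n} r eq (G , deg) = complement G , λ v → suc-injective (+-cancelˡ-≡ r _ _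
  (trans (trans (cong (_+ suc (degree (graph (complement G)) v)) (sym (deg v))) (degree-complement G v)) (sym eq)))

-- The inner graphs.

empty : ∀ n → Reg n 0
empty n = edgeless n , λ v → trans (degree≡sum (graph (edgeless n)) v) (trans (sum-const n 0) (*-zeroʳ n))

complete : ∀ d → Reg (suc d) d
complete d = regularComplement 0 refl (empty (suc d))

infixr 5 _⊕_
-- Disjoint union is composition over two isolated points, so all outer degrees vanish.
_⊕_ : Reg m d → Reg n d → Reg (m + n) d
_⊕_ {m} {d} {n} G G′ = subst (λ k → Reg k d) (cong (m +_) (+-identityʳ n))
  (regularCompose (edgeless 2) (lookup (m ∷ n ∷ [])) (λ _ → d)
    (λ { zero → +-identityʳ d ; (suc zero) → +-identityʳ d })
    (λ { zero → G ; (suc zero) → G′ }))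

matching : ∀ k → Reg (k * 2) 1
matching zero    = edgeless 0 , λ ()
matching (suc k) = complete 1 ⊕ matching k

triangle : Reg 3 2
triangle = complete 2

-- The 4-cycle as the complement of two disjoint edges.
square : Reg 4 2
square = regularComplement 1 refl (matching 2)

-- The cocktail party graph.
coMatching : ∀ k → Reg (suc k * 2) (k * 2)
coMatching k = regularComplement 1 refl (matching (suc k))

-- On 5 vertices the only 2-regular graph is the pentagon itself.
twoRegular : ∀ k → Reg (6 + k) 2
twoRegular 0                   = triangle ⊕ triangle
twoRegular 1                   = triangle ⊕ square
twoRegular 2                   = square ⊕ square
twoRegular (suc (suc (suc k))) = triangle ⊕ twoRegular k

coTwoRegular : ∀ k → Reg (6 + k) (3 + k)
coTwoRegular k = regularComplement 2 refl (twoRegular k)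

almostMatching : AlmostReg 3 1
almostMatching = almostRegularCompose (edgeless 2) (lookup (1 ∷ 2 ∷ [])) (λ _ → 1)
  (λ { zero → refl ; (suc zero) → refl })
  -- A single vertex is almost 1-regular: its degree is one too low and there is no other vertex.
  (edgeless 1 , zero , inj₂ refl , λ { zero 0≢0 → contradiction refl 0≢0 })
  (λ { zero → complete 1 })

-- The rook graph.

-- This is the line graph of K₃,₃, so an induced pentagon would come from a 5-cycle in a bipartite
-- graph. The proof below is an exhaustive check.
rook : PentagonFreeGraph 9
rook = record
  { graph = record
    { adj        = _~_
    ; adj-sym    = from-yes (all? λ i → all? λ j → (i ~ j) Bool.≟ (j ~ i))
    ; adj-irrefl = from-yes (all? λ i → (i ~ i) Bool.≟ false)
    }
  ; pentagonFree = λ {a} {b} {c} {d} {e} (pentagon ab bc cd de ea ac bd ce da eb) →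
      no-pentagon a b ab c bc ac d cd da bd e de ea eb ce
  }
  where
  -- Cells are adjacent when exactly one of their two coordinates agrees.
  _~_ : Fin 9 → Fin 9 → Bool
  i ~ j = does (proj₁ (quotRem {3} 3 i) ≟ proj₁ (quotRem {3} 3 j))
      xor does (proj₂ (quotRem {3} 3 i) ≟ proj₂ (quotRem {3} 3 j))
  -- Each condition follows the quantifier that completes it, so the search drops partial pentagons
  -- early.
  no-pentagon : ∀ a b → (a ~ b) ≡ true → ∀ c → (b ~ c) ≡ true → (a ~ c) ≡ false →
    ∀ d → (c ~ d) ≡ true → (d ~ a) ≡ false → (b ~ d) ≡ false →
    ∀ e → (d ~ e) ≡ true → (e ~ a) ≡ true → (e ~ b) ≡ false → (c ~ e) ≢ false
  no-pentagon = from-yes (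
    all? λ a → all? λ b → (a ~ b) Bool.≟ true →-dec
    all? λ c → (b ~ c) Bool.≟ true →-dec (a ~ c) Bool.≟ false →-dec
    all? λ d → (c ~ d) Bool.≟ true →-dec (d ~ a) Bool.≟ false →-dec (b ~ d) Bool.≟ false →-dec
    all? λ e → (d ~ e) Bool.≟ true →-dec (e ~ a) Bool.≟ true →-dec (e ~ b) Bool.≟ false →-dec
      ¬? ((c ~ e) Bool.≟ false))

-- Weighted rook graphs and their growth.

sum-linear : ∀ k (f g : Vector ℕ n) → sum (λ i → f i + k * g i) ≡ sum f + k * sum g
sum-linear k f g = trans (∑-distrib-+ f (λ i → k * g i)) (cong (sum f +_) (sym (*-distribˡ-sum k g)))

outerDegree-linear : ∀ k (H : Graph h) (f g : Vector ℕ h) i →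
  outerDegree H (λ j → f j + k * g j) i ≡ outerDegree H f i + k * outerDegree H g i
outerDegree-linear k H f g i = trans (sum-cong-≗ λ j → distrib [ adj H i j ] k (f j) (g j))
  (sum-linear k (λ j → [ adj H i j ] * f j) (λ j → [ adj H i j ] * g j))
  where
  distrib : ∀ a k x y → a * (x + k * y) ≡ a * x + k * (a * y)
  distrib = solve-∀

-- A row gives the number of vertices and the inner degree of each part.
size deg : Vec (ℕ × ℕ) h → Vector ℕ h
size r i = proj₁ (lookup r i)
deg  r i = proj₂ (lookup r i)

Balanced : Vec (ℕ × ℕ) 9 → ℕ → Set
Balanced r D = ∀ i → deg r i + outerDegree (graph rook) (size r) i ≡ D

balanced? : ∀ r D → Dec (Balanced r D)
balanced? r D = all? λ i → deg r i + outerDegree (graph rook) (size r) i ℕ.≟ D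

-- The row can be inferred from the types of the graphs supplied, and its balance is then decided by
-- evaluation.
rookRegular : ∀ {r} D {b : True (balanced? r D)} → All (uncurry Reg) r → Reg (sum (size r)) D
rookRegular {r} D {b} G = regularCompose rook (size r) (deg r) (toWitness b) (lookup⁺ G)

rookAlmostRegular : ∀ {n d r} D {b : True (balanced? ((n , d) ∷ r) D)} →
  AlmostReg n d → All (uncurry Reg) r → AlmostReg (sum (size ((n , d) ∷ r))) D
rookAlmostRegular {n} {d} {r} D {b} A G =
  almostRegularCompose rook (size ((n , d) ∷ r)) (deg ((n , d) ∷ r)) (toWitness b) A (lookup⁺ G)

-- The parts 1, 2, 3 and 6, the rook neighbours of part 0, keep their co-degree when they grow by one vertex;
-- the parts 4, 5, 7 and 8 keep their degree.
growth : Vec (ℕ × ℕ) 9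
growth = (0 , 0) ∷ (1 , 1) ∷ (1 , 1) ∷ (1 , 1) ∷ (1 , 0) ∷ (1 , 0) ∷ (1 , 1) ∷ (1 , 0) ∷ (1 , 0) ∷ []

module Grown (k : ℕ) (r : Vec (ℕ × ℕ) 9) where

  grownSize grownDeg : Vector ℕ 9
  grownSize i = size r i + k * size growth i
  grownDeg  i = deg r i + k * deg growth i

  -- The balance condition is linear in sizes and degrees, and `growth` itself is balanced with
  -- value 4; two finite checks thus settle every `k`.
  grown-balanced : ∀ {D} → Balanced r D → ∀ i → grownDeg i + outerDegree (graph rook) grownSize i ≡ D + k * 4
  grown-balanced {D} b i = begin
    grownDeg i + outerDegree (graph rook) grownSize i
      ≡⟨ cong (grownDeg i +_) (outerDegree-linear k (graph rook) (size r) (size growth) i) ⟩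
    (deg r i + k * deg growth i) + (o + k * o′)
      ≡⟨ rearrange (deg r i) (deg growth i) o o′ k ⟩
    (deg r i + o) + k * (deg growth i + o′)
      ≡⟨ cong₂ (λ x y → x + k * y) (b i) (from-yes (balanced? growth 4) i) ⟩
    D + k * 4 ∎
    where
    open ≡-Reasoning
    o  = outerDegree (graph rook) (size r) i
    o′ = outerDegree (graph rook) (size growth) i
    rearrange : ∀ a b c e k → (a + k * b) + (c + k * e) ≡ (a + c) + k * (b + e)
    rearrange = solve-∀

  grown-total : sum grownSize ≡ sum (size r) + k * 8
  grown-total = sum-linear k (size r) (size growth)

GrownReg : ℕ → ℕ × ℕ → ℕ × ℕ → Set
GrownReg k (n , d) (σ , δ) = Reg (n + k * σ) (d + k * δ)

rookRegularFamily : ∀ {r} D k {b : True (balanced? r D)} →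
  Pointwise (GrownReg k) r growth → Reg (sum (size r) + k * 8) (D + k * 4)
rookRegularFamily {r} D k {b} G = subst (λ n → Reg n (D + k * 4)) grown-total
  (regularCompose rook grownSize grownDeg (grown-balanced (toWitness b)) (Pointwise.lookup G))
  where open Grown k r

-- Part 0 has growth `(0 , 0)`, so one almost regular graph `A` serves for every `k`.
rookAlmostRegularFamily : ∀ {n d r} D k {b : True (balanced? ((n , d) ∷ r) D)} →
  AlmostReg n d → Pointwise (GrownReg k) r (Vec.tail growth) → AlmostReg (sum (size ((n , d) ∷ r)) + k * 8) (D + k * 4)
rookAlmostRegularFamily {n} {d} {r} D k {b} A G = subst (λ n → AlmostReg n (D + k * 4)) grown-total
  (almostRegularCompose rook grownSize grownDeg (grown-balanced (toWitness b))
    (subst (λ z → AlmostReg (n + z) (d + z)) (sym (*-zeroʳ k))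
      (subst₂ AlmostReg (sym (+-identityʳ n)) (sym (+-identityʳ d)) A))
    (Pointwise.lookup G))
  where open Grown k ((n , d) ∷ r)

-- Growing parts and the families by residue modulo 8.

-- `fixed`, `sparse` and `dense` realise the growth entries `(0 , 0)`, `(1 , 0)` and `(1 , 1)`.
fixed : ∀ k → Reg n d → Reg (n + k * 0) (d + k * 0)
fixed {n} {d} k G rewrite *-zeroʳ k | +-identityʳ n | +-identityʳ d = G

sparse : ∀ k → Reg (n + k) d → Reg (n + k * 1) (d + k * 0)
sparse {n} {d} k G rewrite *-identityʳ k | *-zeroʳ k | +-identityʳ d = G

-- `r` is the co-degree, which stays constant while size and degree both grow by `k`.
dense : ∀ r k → Reg (r + suc d + k) r → Reg (r + suc d + k * 1) (d + k * 1)
dense {d} r k G rewrite *-identityʳ k = regularComplement r (sym (+-assoc r (suc d) k)) G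

-- The sizes and degrees in the rows below were found by computer search.
regular₁ : ∀ k → Reg (17 + k * 8) (8 + k * 4)
regular₁ k = rookRegularFamily
  {(1 , 0) ∷ (2 , 1) ∷ (2 , 1) ∷ (2 , 1) ∷ (2 , 0) ∷ (2 , 0) ∷ (2 , 1) ∷ (2 , 0) ∷ (2 , 0) ∷ []} 8 k
  (fixed k (empty 1) ∷ dense 0 k (empty _) ∷ dense 0 k (empty _) ∷
   dense 0 k (empty _) ∷ sparse k (empty _) ∷ sparse k (empty _) ∷
   dense 0 k (empty _) ∷ sparse k (empty _) ∷ sparse k (empty _) ∷ [])

-- The family starts at 53 vertices, where the parts that use `twoRegular` have at least six
-- vertices; smaller orders get rows of their own.
regular₅ : ∀ k → Reg (21 + k * 8) (10 + k * 4)
regular₅ 0 = rookRegular 10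
  (empty 3 ∷ empty 3 ∷ empty 3 ∷ complete 1 ∷ complete 1 ∷ complete 1 ∷ complete 1 ∷ complete 1 ∷ complete 1 ∷ [])
regular₅ 1 = rookRegular 14
  (complete 3 ∷ empty 3 ∷ complete 1 ∷ empty 3 ∷ matching 2 ∷ complete 2 ∷ empty 3 ∷ matching 2 ∷ complete 2 ∷ [])
regular₅ 2 = rookRegular 18
  (empty 3 ∷ coTwoRegular 0 ∷ matching 2 ∷ complete 3 ∷ empty 4 ∷ square ∷ complete 3 ∷ empty 4 ∷ square ∷ [])
regular₅ 3 = rookRegular 22
  (empty 7 ∷ empty 7 ∷ empty 7 ∷ complete 3 ∷ complete 3 ∷ complete 3 ∷ complete 3 ∷ complete 3 ∷ complete 3 ∷ [])
regular₅ (suc (suc (suc (suc k)))) = rookRegularFamily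
  {(3 , 0) ∷ (8 , 5) ∷ (6 , 3) ∷ (6 , 5) ∷ (6 , 0) ∷ (6 , 2) ∷ (6 , 5) ∷ (6 , 0) ∷ (6 , 2) ∷ []} 26 k
  (fixed k (empty 3) ∷ dense 2 k (twoRegular _) ∷ dense 2 k (twoRegular _) ∷
   dense 0 k (empty _) ∷ sparse k (empty _) ∷ sparse k (twoRegular _) ∷
   dense 0 k (empty _) ∷ sparse k (empty _) ∷ sparse k (twoRegular _) ∷ [])

-- `k ≡ 1` is the excluded order 27. The family starts at 59 vertices.
almostRegular₃ : ∀ k → k ≢ 1 → AlmostReg (19 + k * 8) (9 + k * 4)
almostRegular₃ 0 _ = rookAlmostRegular 9 almostMatching
  (empty 2 ∷ empty 2 ∷ empty 2 ∷ complete 1 ∷ complete 1 ∷ empty 2 ∷ complete 1 ∷ complete 1 ∷ [])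
almostRegular₃ 1 1≢1 = contradiction refl 1≢1
almostRegular₃ 2 _ = rookAlmostRegular 17 almostMatching
  (square ∷ square ∷ square ∷ matching 2 ∷ matching 2 ∷ square ∷ matching 2 ∷ matching 2 ∷ [])
almostRegular₃ 3 _ = rookAlmostRegular 21 almostMatching
  (complete 5 ∷ matching 2 ∷ coMatching 2 ∷ empty 5 ∷ empty 5 ∷ square ∷ empty 4 ∷ coMatching 2 ∷ [])
almostRegular₃ 4 _ = rookAlmostRegular 25 almostMatching
  (coMatching 2 ∷ coMatching 2 ∷ coMatching 2 ∷ matching 3 ∷ matching 3 ∷ coMatching 2 ∷ matching 3 ∷ matching 3 ∷ [])
almostRegular₃ (suc (suc (suc (suc (suc k))))) _ = rookAlmostRegularFamily
  {r = (8 , 7) ∷ (6 , 3) ∷ (7 , 4) ∷ (7 , 0) ∷ (8 , 2) ∷ (7 , 6) ∷ (6 , 0) ∷ (7 , 2) ∷ []} 29 k almostMatching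
  (dense 0 k (empty _) ∷ dense 2 k (twoRegular _) ∷ dense 2 k (twoRegular _) ∷
   sparse k (empty _) ∷ sparse k (twoRegular _) ∷ dense 0 k (empty _) ∷
   sparse k (empty _) ∷ sparse k (twoRegular _) ∷ [])

-- The family starts at 47 vertices.
almostRegular₇ : ∀ k → AlmostReg (23 + k * 8) (11 + k * 4)
almostRegular₇ 0 = rookAlmostRegular 11 almostMatching
  (empty 3 ∷ empty 3 ∷ complete 1 ∷ triangle ∷ empty 2 ∷ complete 1 ∷ empty 2 ∷ triangle ∷ [])
almostRegular₇ 1 = rookAlmostRegular 15 almostMatching
  (matching 2 ∷ matching 2 ∷ complete 2 ∷ square ∷ empty 3 ∷ complete 2 ∷ empty 3 ∷ square ∷ [])
almostRegular₇ 2 = rookAlmostRegular 19 almostMatching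
  (coTwoRegular 0 ∷ matching 2 ∷ complete 4 ∷ empty 5 ∷ empty 4 ∷ complete 2 ∷ empty 4 ∷ complete 4 ∷ [])
almostRegular₇ (suc (suc (suc k))) = rookAlmostRegularFamily
  {r = (6 , 3) ∷ (6 , 3) ∷ (5 , 4) ∷ (6 , 2) ∷ (5 , 0) ∷ (5 , 4) ∷ (5 , 0) ∷ (6 , 2) ∷ []} 23 k almostMatching
  (dense 2 k (twoRegular _) ∷ dense 2 k (twoRegular _) ∷ dense 0 k (empty _) ∷
   sparse k (twoRegular _) ∷ sparse k (empty _) ∷ dense 0 k (empty _) ∷
   sparse k (empty _) ∷ sparse k (twoRegular _) ∷ [])

-- The graph on 27 vertices.

-- Each of the three copies of K₂ ∪ K₁ contributes one vertex of degree 12; all other degrees are 13.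
graph₂₇ : PentagonFreeGraph 27
graph₂₇ = compose rook (lookup (4 ∷ 3 ∷ 3 ∷ 3 ∷ 2 ∷ 3 ∷ 3 ∷ 3 ∷ 3 ∷ [])) (lookup⁺ {P = PentagonFreeGraph}
  (proj₁ (matching 2) ∷ proj₁ almostMatching ∷ edgeless 3 ∷
   proj₁ almostMatching ∷ proj₁ (complete 1) ∷ proj₁ (complete 2) ∷
   edgeless 3 ∷ proj₁ (complete 2) ∷ proj₁ almostMatching ∷ []))

-- Goodman's formula predicts 2925 - (24 * 13 * 13 + 3 * 12 * 14) / 2 = 645; here the count is
-- evaluated directly.
triAntiCount₂₇ : triAntiCount (graph graph₂₇) ≡ 645
triAntiCount₂₇ = refl

-- Assembly over the residues of n.

half : n ≡ suc (d * 2) → (n ∸ 1) / 2 ≡ d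
half {d = d} refl = m*n/n≡m d 2

regular⇒ : n ≡ suc (d * 2) → Reg n d → Σ (Graph n) λ G → C5Free G × Regular G ((n ∸ 1) / 2)
regular⇒ eq (G , deg) = graph G , pentagonFree⇒C5Free (graph G) (pentagonFree G) ,
  subst (Regular (graph G)) (sym (half eq)) deg

almostRegular⇒ : n ≡ suc (d * 2) → AlmostReg n d → Σ (Graph n) λ G → C5Free G × AlmostRegular G ((n ∸ 1) / 2)
almostRegular⇒ eq (G , deg) = graph G , pentagonFree⇒C5Free (graph G) (pentagonFree G) ,
  subst (AlmostRegular (graph G)) (sym (half eq)) deg

[a+k*8]%4 : ∀ a k → (a + k * 8) % 4 ≡ a % 4
[a+k*8]%4 a k = trans (cong (λ x → (a + x) % 4) (sym (*-assoc k 2 4))) ([m+kn]%n≡m%n a (k * 2) 4)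

module _ (a k : ℕ) {c : ℕ} where
  impossible : {A : Set} → a % 4 ≢ c → (a + k * 8) % 4 ≡ c → A
  impossible a≢c eq = contradiction (trans (sym ([a+k*8]%4 a k)) eq) a≢c

Claim : ℕ → Set
Claim n = (n % 4 ≡ 1 → Σ (Graph n) λ G → C5Free G × Regular G ((n ∸ 1) / 2))
        × (n % 4 ≡ 3 → Σ (Graph n) λ G → C5Free G × AlmostRegular G ((n ∸ 1) / 2))

-- The even `r` give odd orders, alternately 1 and 3 modulo 4, one family each; for odd `r` the
-- order is even and both hypotheses fail.
residues : ∀ (r : Fin 8) k → 17 + (toℕ r + k * 8) ≢ 27 → Claim (17 + (toℕ r + k * 8))
residues zero k _ =
  (λ _ → regular⇒ (eq k) (regular₁ k)) , impossible 17 k λ ()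
  where eq : ∀ k → 17 + k * 8 ≡ suc ((8 + k * 4) * 2)
        eq = solve-∀
residues (suc zero) k _ =
  impossible 18 k (λ ()) , impossible 18 k λ ()
residues (suc (suc zero)) k n≢27 =
  impossible 19 k (λ ()) , λ _ → almostRegular⇒ (eq k) (almostRegular₃ k λ k≡1 → n≢27 (cong (λ k → 19 + k * 8) k≡1))
  where eq : ∀ k → 19 + k * 8 ≡ suc ((9 + k * 4) * 2)
        eq = solve-∀
residues (suc (suc (suc zero))) k _ =
  impossible 20 k (λ ()) , impossible 20 k λ ()
residues (suc (suc (suc (suc zero)))) k _ =
  (λ _ → regular⇒ (eq k) (regular₅ k)) , impossible 21 k λ ()
  where eq : ∀ k → 21 + k * 8 ≡ suc ((10 + k * 4) * 2)
        eq = solve-∀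
residues (suc (suc (suc (suc (suc zero))))) k _ =
  impossible 22 k (λ ()) , impossible 22 k λ ()
residues (suc (suc (suc (suc (suc (suc zero)))))) k _ =
  impossible 23 k (λ ()) , λ _ → almostRegular⇒ (eq k) (almostRegular₇ k)
  where eq : ∀ k → 23 + k * 8 ≡ suc ((11 + k * 4) * 2)
        eq = solve-∀
residues (suc (suc (suc (suc (suc (suc (suc zero))))))) k _ =
  impossible 24 k (λ ()) , impossible 24 k λ ()

byExcess : (∃ λ o → 17 + o ≡ n) → n ≢ 27 → Claim n
byExcess (o , refl) = byQuotient (o divMod 8)
  where
  -- The excess is generalised to a variable so that the division equation can be matched with
  -- `refl`.
  byQuotient : ∀ {o} → DivMod o 8 → 17 + o ≢ 27 → Claim (17 + o)
  byQuotient (result k r refl) = residues r k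

theorem3 : (∀ (n : ℕ) → n % 2 ≡ 1 → 17 ≤ n → n ≢ 27 →
    (n % 4 ≡ 1 → Σ (Graph n) λ G → C5Free G × Regular G ((n ∸ 1) / 2))
    × (n % 4 ≡ 3 → Σ (Graph n) λ G → C5Free G × AlmostRegular G ((n ∸ 1) / 2)))
    × (Σ (Graph 27) λ G → C5Free G × triAntiCount G ≡ 645)
theorem3 = large , graph graph₂₇ , pentagonFree⇒C5Free (graph graph₂₇) (pentagonFree graph₂₇) , triAntiCount₂₇
  where
  large : ∀ n → n % 2 ≡ 1 → 17 ≤ n → n ≢ 27 → Claim n
  large n _ 17≤n = byExcess (m≤n⇒∃[o]m+o≡n 17≤n)
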